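{- Let $\mathcal{Q}$ be a small quantaloid. For any $\mathcal{Q}$-distributor $\phi:\mathbb{A}\nrightarrow\mathbb{B}$ between $\mathcal{Q}$-categories, a separated complete $\mathcal{Q}$-category $\mathbb{X}$ is isomorphic to $\mathsf{K}\phi$ if, and only if, there exist a dense $\mathcal{Q}$-functor $F:\mathbb{B}\to\mathbb{X}$ and a codense $\mathcal{Q}$-functor $G:\overline{\mathbb{A}}\to\mathbb{X}$ with $\phi^{\triangleright}=G^{\natural}\circ F_{\natural}$.
   Context: A quantaloid $\mathcal{Q}$ is a category whose hom-sets are complete lattices and whose composition $\circ$ preserves joins in each variable; small means it has a set $\mathcal{Q}_0$ of objects; $1_q$ denotes identities. For $u:p\to q$, $v:q\to r$, $w:p\to r$, the implications $w\swarrow u:q\to r$ and $v\searrow w:p\to q$ are determined by $v\circ u\leq w\iff v\leq w\swarrow u\iff u\leq v\searrow w$. A $\mathcal{Q}$-category $\mathbb{A}$ is a set $\mathbb{A}_0$ with a type map $|\cdot|:\mathbb{A}_0\to\mathcal{Q}_0$ and arrows $\mathbb{A}(x,y)\in\mathcal{Q}(|x|,|y|)$ such that $1_{|x|}\leq\mathbb{A}(x,x)$ and $\mathbb{A}(y,z)\circ\mathbb{A}(x,y)\leq\mathbb{A}(x,z)$. A $\mathcal{Q}$-subcategory is a subset of objects with the same hom-arrows. $x\leq y$ iff $|x|=|y|$ and $1_{|x|}\leq\mathbb{A}(x,y)$; $x\cong y$ means $x\leq y$ and $y\leq x$; $\mathbb{A}$ is separated if $x\cong y$ implies $x=y$. A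 $\mathcal{Q}$-functor $F:\mathbb{A}\to\mathbb{B}$ is a type-preserving map $\mathbb{A}_0\to\mathbb{B}_0$ with $\mathbb{A}(x,x')\leq\mathbb{B}(Fx,Fx')$; an isomorphism is a $\mathcal{Q}$-functor with a two-sided inverse $\mathcal{Q}$-functor. A $\mathcal{Q}$-distributor $\phi:\mathbb{A}\nrightarrow\mathbb{B}$ is a family of arrows $\phi(x,y):|x|\to|y|$ with $\mathbb{B}(y,y')\circ\phi(x,y)\circ\mathbb{A}(x',x)\leq\phi(x',y')$. For $\phi:\mathbb{A}\nrightarrow\mathbb{B}$, $\psi:\mathbb{B}\nrightarrow\mathbb{C}$, $\xi:\mathbb{A}\nrightarrow\mathbb{C}$: $(\psi\circ\phi)(x,z)=\bigvee_{y}\psi(y,z)\circ\phi(x,y)$, $(\xi\swarrow\phi)(y,z)=\bigwedge_{x}\xi(x,z)\swarrow\phi(x,y)$, $(\psi\searrow\xi)(x,y)=\bigwedge_{z}\psi(y,z)\searrow\xi(x,z)$. For $F:\mathbb{A}\to\mathbb{B}$: $F_\natural(x,y)=\mathbb{B}(Fx,y)$ (a distributor $\mathbb{A}\nrightarrow\mathbb{B}$), $F^\natural(y,x)=\mathbb{B}(y,Fx)$ (a distributor $\mathbb{B}\nrightarrow\mathbb{A}$). $\{q\}$ is the $\mathcal{Q}$-category with one object of type $q$ and hom-arrow $1_q$. $\mathsf{P}\mathbb{A}$ is the $\mathcal{Q}$-category of presheaves $\mu:\mathbb{A}\nrightarrow\{q\}$ (of type $q$) with $\mathsf{P}\mathbb{A}(\mu,\mu')=\mu'\swarrow\mu$;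 $\mathsf{P}^\dagger\mathbb{A}$ is the $\mathcal{Q}$-category of copresheaves $\lambda:\{q\}\nrightarrow\mathbb{A}$ (of type $q$) with $\mathsf{P}^\dagger\mathbb{A}(\lambda,\lambda')=\lambda'\searrow\lambda$. For $F:\mathbb{A}\to\mathbb{B}$, $\mu\in\mathsf{P}\mathbb{A}$, $\lambda\in\mathsf{P}^\dagger\mathbb{A}$: $\mathrm{colim}_\mu F$ is an object of type $|\mu|$ with $\mathbb{B}(\mathrm{colim}_\mu F,-)=F_\natural\swarrow\mu$; $\lim_\lambda F$ is an object of type $|\lambda|$ with $\mathbb{B}(-,\lim_\lambda F)=\lambda\searrow F^\natural$. $\mathbb{B}$ is complete if it admits all weighted colimits (equivalently, all weighted limits). $F:\mathbb{A}\to\mathbb{B}$ is dense (resp. codense) if every $y\in\mathbb{B}_0$ is $\cong\mathrm{colim}_\mu F$ for some $\mu\in\mathsf{P}\mathbb{A}$ (resp. $\cong\lim_\lambda F$ for some $\lambda\in\mathsf{P}^\dagger\mathbb{A}$). For $\phi:\mathbb{A}\nrightarrow\mathbb{B}$: $\phi^*:\mathsf{P}\mathbb{B}\to\mathsf{P}\mathbb{A}$, $\phi^*\lambda=\lambda\circ\phi$, and $\phi_*:\mathsf{P}\mathbb{A}\to\mathsf{P}\mathbb{B}$, $\phi_*\mu=\mu\swarrow\phi$, form the Kan adjunction $\phi^*\dashv\phi_*$; $\mathsf{K}\phi$ is the $\mathcal{Q}$-subcategory of $\mathsf{P}\mathbb{B}$ of all $\lambda$ with $\phi_*\phi^*\lambda=\lambda$.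 $\overline{\mathbb{A}}$ is the $\mathcal{Q}$-subcategory of $\mathsf{P}\mathbb{A}$ whose objects are the presheaves of the form $u\swarrow\mathbb{A}(a,-)$ with $a\in\mathbb{A}_0$ and $u$ a $\mathcal{Q}$-arrow with domain $|a|$. $\mathbb{A}^{\triangleright}:\mathbb{A}\nrightarrow\overline{\mathbb{A}}$ is the distributor $\mathbb{A}^{\triangleright}(a,\mu)=\mu(a)$, and $\phi^{\triangleright}:=\mathbb{A}^{\triangleright}\swarrow\phi:\mathbb{B}\nrightarrow\overline{\mathbb{A}}$. -}

module Defs where

open import Level using (Level; suc)
open import Data.Product using (Σ; ∃-syntax; _×_; _,_; proj₁; proj₂)
open import Relation.Binary.Bundles using (Poset; Setoid)
open import Relation.Binary.PropositionalEquality using (_≡_; refl)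
import Relation.Binary.PropositionalEquality as ≡
import Relation.Binary.Construct.On as On

-- Every set has its elements in the universe `Set ℓ`, and joins are taken of
-- families indexed by arbitrary types in `Set ℓ`.  Subsets of a carrier are
-- among these families, and conversely every family has an image.

record CompleteLattice (ℓ : Level) : Set (suc ℓ) where
  field
    poset : Poset ℓ ℓ ℓ
  open Poset poset public
    renaming (refl to ≤-refl; reflexive to ≤-reflexive; trans to ≤-trans)
  field
    ⋁       : {I : Set ℓ} → (I → Carrier) → Carrier
    ⋁-upper : {I : Set ℓ} (f : I → Carrier) (i : I) → f i ≤ ⋁ f
    ⋁-least : {I : Set ℓ} (f : I → Carrier) {u : Carrier} → (∀ i → f i ≤ u) → ⋁ f ≤ u

  ⋀ : {I : Set ℓ} → (I → Carrier) → Carrier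
  ⋀ {I} f = ⋁ {I = Σ Carrier λ v → ∀ i → v ≤ f i} proj₁

  ⋀-lower : {I : Set ℓ} (f : I → Carrier) (i : I) → ⋀ f ≤ f i
  ⋀-lower f i = ⋁-least proj₁ (λ (v , v≤f) → v≤f i)

  ⋀-greatest : {I : Set ℓ} (f : I → Carrier) {u : Carrier} → (∀ i → u ≤ f i) → u ≤ ⋀ f
  ⋀-greatest f u≤f = ⋁-upper proj₁ (_ , u≤f)

  ⋀-mono : {I : Set ℓ} {f g : I → Carrier} → (∀ i → f i ≤ g i) → ⋀ f ≤ ⋀ g
  ⋀-mono {f = f} {g} f≤g = ⋀-greatest g (λ i → ≤-trans (⋀-lower f i) (f≤g i))

module HomLattices {ℓ : Level} {Obj : Set ℓ} (Hom : Obj → Obj → CompleteLattice ℓ) where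
  Arr : Obj → Obj → Set ℓ
  Arr p q = CompleteLattice.Carrier (Hom p q)

  module _ {p q : Obj} where
    open CompleteLattice (Hom p q) public hiding (Carrier; poset)

record Quantaloid (ℓ : Level) : Set (suc ℓ) where
  field
    Obj : Set ℓ
    Hom : Obj → Obj → CompleteLattice ℓ

  open HomLattices Hom public

  infixr 9 _∘_
  field
    1ₐ      : ∀ {q} → Arr q q
    _∘_     : ∀ {p q r} → Arr q r → Arr p q → Arr p r
    ∘-cong  : ∀ {p q r} {v v′ : Arr q r} {u u′ : Arr p q} →
              v ≈ v′ → u ≈ u′ → (v ∘ u) ≈ (v′ ∘ u′)
    ∘-assoc : ∀ {p q r s} (w : Arr r s) (v : Arr q r) (u : Arr p q) →
              ((w ∘ v) ∘ u) ≈ (w ∘ (v ∘ u))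
    ∘-idˡ   : ∀ {p q} (u : Arr p q) → (1ₐ ∘ u) ≈ u
    ∘-idʳ   : ∀ {p q} (u : Arr p q) → (u ∘ 1ₐ) ≈ u
    ∘-⋁ˡ    : ∀ {p q r} {I : Set ℓ} (v : I → Arr q r) (u : Arr p q) →
              (⋁ v ∘ u) ≈ ⋁ (λ i → v i ∘ u)
    ∘-⋁ʳ    : ∀ {p q r} {I : Set ℓ} (v : Arr q r) (u : I → Arr p q) →
              (v ∘ ⋁ u) ≈ ⋁ (λ i → v ∘ u i)

  infix 8 _↙_ _↘_

  _↙_ : ∀ {p q r} → Arr p r → Arr p q → Arr q r
  _↙_ {q = q} {r} w u = ⋁ {I = Σ (Arr q r) λ v → (v ∘ u) ≤ w} proj₁

  _↘_ : ∀ {p q r} → Arr q r → Arr p r → Arr p q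
  _↘_ {p = p} {q} v w = ⋁ {I = Σ (Arr p q) λ u → (v ∘ u) ≤ w} proj₁

  ∘-monoˡ : ∀ {p q r} {v v′ : Arr q r} (u : Arr p q) → v ≤ v′ → (v ∘ u) ≤ (v′ ∘ u)
  ∘-monoˡ {q = q} {r} {v} {v′} u v≤v′ =
    ≤-trans (⋁-upper (λ i → proj₁ i ∘ u) (v , v≤v′))
      (≤-trans (≤-reflexive (Eq.sym (∘-⋁ˡ proj₁ u)))
        (≤-reflexive (∘-cong ⋁↓≈ Eq.refl)))
    where
    ⋁↓≈ : ⋁ {I = Σ (Arr q r) (_≤ v′)} proj₁ ≈ v′
    ⋁↓≈ = antisym (⋁-least proj₁ proj₂) (⋁-upper proj₁ (v′ , ≤-refl))

  ∘-monoʳ : ∀ {p q r} (v : Arr q r) {u u′ : Arr p q} → u ≤ u′ → (v ∘ u) ≤ (v ∘ u′)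
  ∘-monoʳ {p} {q} v {u} {u′} u≤u′ =
    ≤-trans (⋁-upper (λ i → v ∘ proj₁ i) (u , u≤u′))
      (≤-trans (≤-reflexive (Eq.sym (∘-⋁ʳ v proj₁)))
        (≤-reflexive (∘-cong Eq.refl ⋁↓≈)))
    where
    ⋁↓≈ : ⋁ {I = Σ (Arr p q) (_≤ u′)} proj₁ ≈ u′
    ⋁↓≈ = antisym (⋁-least proj₁ proj₂) (⋁-upper proj₁ (u′ , ≤-refl))

  ∘-mono : ∀ {p q r} {v v′ : Arr q r} {u u′ : Arr p q} →
           v ≤ v′ → u ≤ u′ → (v ∘ u) ≤ (v′ ∘ u′)
  ∘-mono v≤v′ u≤u′ = ≤-trans (∘-monoˡ _ v≤v′) (∘-monoʳ _ u≤u′)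

  ↙-intro : ∀ {p q r} {u : Arr p q} {v : Arr q r} {w : Arr p r} →
            (v ∘ u) ≤ w → v ≤ (w ↙ u)
  ↙-intro v∘u≤w = ⋁-upper proj₁ (_ , v∘u≤w)

  ↙-elim : ∀ {p q r} {u : Arr p q} {v : Arr q r} {w : Arr p r} →
           v ≤ (w ↙ u) → (v ∘ u) ≤ w
  ↙-elim {u = u} v≤w↙u = ≤-trans (∘-monoˡ u v≤w↙u)
    (≤-trans (≤-reflexive (∘-⋁ˡ proj₁ u)) (⋁-least _ proj₂))

  ↘-intro : ∀ {p q r} {u : Arr p q} {v : Arr q r} {w : Arr p r} →
            (v ∘ u) ≤ w → u ≤ (v ↘ w)
  ↘-intro v∘u≤w = ⋁-upper proj₁ (_ , v∘u≤w)

  ↘-elim : ∀ {p q r} {u : Arr p q} {v : Arr q r} {w : Arr p r} →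
           u ≤ (v ↘ w) → (v ∘ u) ≤ w
  ↘-elim {v = v} u≤v↘w = ≤-trans (∘-monoʳ v u≤v↘w)
    (≤-trans (≤-reflexive (∘-⋁ʳ v proj₁)) (⋁-least _ proj₂))

  ∘-assoc-≤ : ∀ {p q r s} {w : Arr r s} {v : Arr q r} {u : Arr p q} →
              ((w ∘ v) ∘ u) ≤ (w ∘ (v ∘ u))
  ∘-assoc-≤ = ≤-reflexive (∘-assoc _ _ _)

  ∘-assoc-≥ : ∀ {p q r s} {w : Arr r s} {v : Arr q r} {u : Arr p q} →
              (w ∘ (v ∘ u)) ≤ ((w ∘ v) ∘ u)
  ∘-assoc-≥ = ≤-reflexive (Eq.sym (∘-assoc _ _ _))

  ↙-mono : ∀ {p q r} {u u′ : Arr p q} {w w′ : Arr p r} →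
           w ≤ w′ → u′ ≤ u → (w ↙ u) ≤ (w′ ↙ u′)
  ↙-mono w≤w′ u′≤u =
    ↙-intro (≤-trans (∘-monoʳ _ u′≤u) (≤-trans (↙-elim ≤-refl) w≤w′))

-- A set of objects with a type map is given by its fibres: `Ob q` is the setoid
-- of objects of type q.  Equality of objects is the equality of that setoid, so
-- that presheaves can be equal when they are pointwise equal.

record QCat {ℓ : Level} (Q : Quantaloid ℓ) : Set (suc ℓ) where
  open Quantaloid Q using (Obj; Arr; 1ₐ; _∘_; _≤_; _≈_)
  field
    Ob : Obj → Setoid ℓ ℓ

  ∣_∣₀ : Obj → Set ℓ
  ∣ q ∣₀ = Setoid.Carrier (Ob q)

  infix 4 _≈₀_
  _≈₀_ : ∀ {q} → ∣ q ∣₀ → ∣ q ∣₀ → Set ℓ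
  _≈₀_ {q} = Setoid._≈_ (Ob q)

  field
    hom      : ∀ {p q} → ∣ p ∣₀ → ∣ q ∣₀ → Arr p q
    hom-cong : ∀ {p q} {x x′ : ∣ p ∣₀} {y y′ : ∣ q ∣₀} →
               x ≈₀ x′ → y ≈₀ y′ → hom x y ≈ hom x′ y′
    hom-id   : ∀ {q} (x : ∣ q ∣₀) → 1ₐ ≤ hom x x
    hom-comp : ∀ {p q r} (x : ∣ p ∣₀) (y : ∣ q ∣₀) (z : ∣ r ∣₀) →
               (hom y z ∘ hom x y) ≤ hom x z

  infix 4 _⊑_ _≅_
  _⊑_ : ∀ {q} → ∣ q ∣₀ → ∣ q ∣₀ → Set ℓ
  x ⊑ y = 1ₐ ≤ hom x y

  _≅_ : ∀ {q} → ∣ q ∣₀ → ∣ q ∣₀ → Set ℓ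
  x ≅ y = (x ⊑ y) × (y ⊑ x)

  -- The index set for joins and meets over all objects, whatever their type.
  Ob₀ : Set ℓ
  Ob₀ = Σ Obj ∣_∣₀

module _ {ℓ : Level} {Q : Quantaloid ℓ} where
  open Quantaloid Q
  open QCat using (Ob; ∣_∣₀; Ob₀; hom; hom-cong; hom-id; hom-comp)

  Separated : QCat Q → Set ℓ
  Separated X = ∀ {q} (x y : ∣ X ∣₀ q) → QCat._≅_ X x y → QCat._≈₀_ X x y

  Subcategory : (A : QCat Q) → (∀ {q} → ∣ A ∣₀ q → Set ℓ) → QCat Q
  Subcategory A P = record
    { Ob       = λ q → On.setoid {B = Σ (∣ A ∣₀ q) P} (Ob A q) proj₁
    ; hom      = λ x y → hom A (proj₁ x) (proj₁ y)
    ; hom-cong = hom-cong A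
    ; hom-id   = λ x → hom-id A (proj₁ x)
    ; hom-comp = λ x y z → hom-comp A (proj₁ x) (proj₁ y) (proj₁ z)
    }

  record QFunctor (A B : QCat Q) : Set ℓ where
    field
      map      : ∀ {q} → ∣ A ∣₀ q → ∣ B ∣₀ q
      map-cong : ∀ {q} {x x′ : ∣ A ∣₀ q} → QCat._≈₀_ A x x′ → QCat._≈₀_ B (map x) (map x′)
      map-hom  : ∀ {p q} (x : ∣ A ∣₀ p) (x′ : ∣ A ∣₀ q) →
                 hom A x x′ ≤ hom B (map x) (map x′)

  open QFunctor

  record Isomorphic (A B : QCat Q) : Set ℓ where
    field
      to      : QFunctor A B
      from    : QFunctor B A
      from-to : ∀ {q} (x : ∣ A ∣₀ q) → QCat._≈₀_ A (map from (map to x)) x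
      to-from : ∀ {q} (y : ∣ B ∣₀ q) → QCat._≈₀_ B (map to (map from y)) y

  infix 4 _⇸_ _≋_

  -- Compatibility with equality of objects follows from `act`.
  record _⇸_ (A B : QCat Q) : Set ℓ where
    field
      app : ∀ {p q} → ∣ A ∣₀ p → ∣ B ∣₀ q → Arr p q
      act : ∀ {p p′ q q′} (x : ∣ A ∣₀ p) (x′ : ∣ A ∣₀ p′) (y : ∣ B ∣₀ q) (y′ : ∣ B ∣₀ q′) →
            (hom B y y′ ∘ app x y ∘ hom A x′ x) ≤ app x′ y′

  open _⇸_

  _≋_ : {A B : QCat Q} → A ⇸ B → A ⇸ B → Set ℓ
  _≋_ {A} {B} φ ψ = ∀ {p q} (x : ∣ A ∣₀ p) (y : ∣ B ∣₀ q) → app φ x y ≈ app ψ x y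

  actˡ : {A B : QCat Q} (φ : A ⇸ B) →
         ∀ {p q q′} (x : ∣ A ∣₀ p) (y : ∣ B ∣₀ q) (y′ : ∣ B ∣₀ q′) →
         (hom B y y′ ∘ app φ x y) ≤ app φ x y′
  actˡ {A} φ x y y′ = ≤-trans
    (∘-monoʳ _ (≤-trans (≤-reflexive (Eq.sym (∘-idʳ _))) (∘-monoʳ _ (hom-id A x))))
    (act φ x x y y′)

  actʳ : {A B : QCat Q} (φ : A ⇸ B) →
         ∀ {p p′ q} (x : ∣ A ∣₀ p) (x′ : ∣ A ∣₀ p′) (y : ∣ B ∣₀ q) →
         (app φ x y ∘ hom A x′ x) ≤ app φ x′ y
  actʳ {B = B} φ x x′ y = ≤-trans
    (≤-trans (≤-reflexive (Eq.sym (∘-idˡ _))) (∘-monoˡ _ (hom-id B y)))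
    (act φ x x′ y y)

  mk⇸ : {A B : QCat Q} (f : ∀ {p q} → ∣ A ∣₀ p → ∣ B ∣₀ q → Arr p q) →
        (∀ {p q q′} (x : ∣ A ∣₀ p) (y : ∣ B ∣₀ q) (y′ : ∣ B ∣₀ q′) →
          (hom B y y′ ∘ f x y) ≤ f x y′) →
        (∀ {p p′ q} (x : ∣ A ∣₀ p) (x′ : ∣ A ∣₀ p′) (y : ∣ B ∣₀ q) →
          (f x y ∘ hom A x′ x) ≤ f x′ y) →
        A ⇸ B
  mk⇸ f l r = record
    { app = f
    ; act = λ x x′ y y′ → ≤-trans (∘-monoʳ _ (r x x′ y)) (l x′ y y′)
    }

  infixr 9 _⊙_
  infix 8 _⇙_ _⇘_

  _⊙_ : {A B C : QCat Q} → B ⇸ C → A ⇸ B → A ⇸ C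
  _⊙_ {A} {B} {C} ψ φ = mk⇸
    (λ x z → ⋁ (f x z))
    (λ x z z′ → ≤-trans (≤-reflexive (∘-⋁ʳ _ _))
      (⋁-least _ λ { (p , y) → ≤-trans ∘-assoc-≥
        (≤-trans (∘-monoˡ _ (actˡ ψ y z z′)) (⋁-upper (f x z′) (p , y))) }))
    (λ x x′ z → ≤-trans (≤-reflexive (∘-⋁ˡ _ _))
      (⋁-least _ λ { (p , y) → ≤-trans ∘-assoc-≤
        (≤-trans (∘-monoʳ _ (actʳ φ x x′ y)) (⋁-upper (f x′ z) (p , y))) }))
    where
    f : ∀ {p r} → ∣ A ∣₀ p → ∣ C ∣₀ r → Ob₀ B → Arr p r
    f x z (_ , y) = app ψ y z ∘ app φ x y

  _⇙_ : {A B C : QCat Q} → A ⇸ C → A ⇸ B → B ⇸ C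
  _⇙_ {A} {B} {C} ξ φ = mk⇸
    (λ y z → ⋀ (f y z))
    (λ y z z′ → ⋀-greatest (f y z′) λ { (p , x) → ↙-intro (≤-trans ∘-assoc-≤
      (≤-trans (∘-monoʳ _ (↙-elim (⋀-lower (f y z) (p , x)))) (actˡ ξ x z z′))) })
    (λ y y′ z → ⋀-greatest (f y′ z) λ { (p , x) → ↙-intro (≤-trans ∘-assoc-≤
      (≤-trans (∘-monoʳ _ (actˡ φ x y′ y)) (↙-elim (⋀-lower (f y z) (p , x))))) })
    where
    f : ∀ {q r} → ∣ B ∣₀ q → ∣ C ∣₀ r → Ob₀ A → Arr q r
    f y z (_ , x) = app ξ x z ↙ app φ x y

  _⇘_ : {A B C : QCat Q} → B ⇸ C → A ⇸ C → A ⇸ B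
  _⇘_ {A} {B} {C} ψ ξ = mk⇸
    (λ x y → ⋀ (f x y))
    (λ x y y′ → ⋀-greatest (f x y′) λ { (r , z) → ↘-intro (≤-trans ∘-assoc-≥
      (≤-trans (∘-monoˡ _ (actʳ ψ y′ y z)) (↘-elim (⋀-lower (f x y) (r , z))))) })
    (λ x x′ y → ⋀-greatest (f x′ y) λ { (r , z) → ↘-intro (≤-trans ∘-assoc-≥
      (≤-trans (∘-monoˡ _ (↘-elim (⋀-lower (f x y) (r , z)))) (actʳ ξ x x′ z))) })
    where
    f : ∀ {p q} → ∣ A ∣₀ p → ∣ B ∣₀ q → Ob₀ C → Arr p q
    f x y (_ , z) = app ψ y z ↘ app ξ x z

  -- F_♮
  graph : {A B : QCat Q} → QFunctor A B → A ⇸ B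
  graph {A} {B} F = mk⇸
    (λ x y → hom B (map F x) y)
    (λ x y y′ → hom-comp B (map F x) y y′)
    (λ x x′ y → ≤-trans (∘-monoʳ _ (map-hom F x′ x))
      (hom-comp B (map F x′) (map F x) y))

  -- F^♮
  cograph : {A B : QCat Q} → QFunctor A B → B ⇸ A
  cograph {A} {B} F = mk⇸
    (λ y x → hom B y (map F x))
    (λ y x x′ → ≤-trans (∘-monoˡ _ (map-hom F x x′))
      (hom-comp B y (map F x) (map F x′)))
    (λ y y′ x → hom-comp B y′ y (map F x))

  -- {q}: its objects of type p are the proofs of p ≡ q, so its only object is
  -- `refl`, of type q.
  Singleton : Obj → QCat Q
  Singleton q = record
    { Ob       = λ p → ≡.setoid (p ≡ q)
    ; hom      = h
    ; hom-cong = λ { refl refl → Eq.refl }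
    ; hom-id   = λ { refl → ≤-refl }
    ; hom-comp = λ { refl refl refl → ≤-reflexive (∘-idˡ _) }
    }
    where
    h : ∀ {p r} → p ≡ q → r ≡ q → Arr p r
    h refl refl = 1ₐ

  Presheaf : QCat Q → Obj → Set ℓ
  Presheaf A q = A ⇸ Singleton q

  Copresheaf : QCat Q → Obj → Set ℓ
  Copresheaf A q = Singleton q ⇸ A

  -- PA(μ,μ′) is the component of μ′ ↙ μ : {|μ|} ⇸ {|μ′|} at the only objects.
  P : QCat Q → QCat Q
  P A = record
    { Ob       = λ q → record
      { Carrier       = Presheaf A q
      ; _≈_           = _≋_
      ; isEquivalence = record
        { refl  = λ _ _ → Eq.refl
        ; sym   = λ e x y → Eq.sym (e x y)
        ; trans = λ e e′ x y → Eq.trans (e x y) (e′ x y)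
        }
      }
    ; hom      = h
    ; hom-cong = λ {_} {_} {μ} {μ′} {ν} {ν′} e e′ → antisym
        (h-mono {μ = μ} {μ′} {ν} {ν′} (λ x → ≤-reflexive (Eq.sym (e x refl))) (λ x → ≤-reflexive (e′ x refl)))
        (h-mono {μ = μ′} {μ} {ν′} {ν} (λ x → ≤-reflexive (e x refl)) (λ x → ≤-reflexive (Eq.sym (e′ x refl))))
    ; hom-id   = λ _ → ⋀-greatest _ λ _ → ↙-intro (≤-reflexive (∘-idˡ _))
    ; hom-comp = λ _ _ _ → ⋀-greatest _ λ i → ↙-intro (≤-trans ∘-assoc-≤
        (≤-trans (∘-monoʳ _ (↙-elim (⋀-lower _ i))) (↙-elim (⋀-lower _ i))))
    }
    where
    h : ∀ {q r} → Presheaf A q → Presheaf A r → Arr q r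
    h μ μ′ = app (μ′ ⇙ μ) refl refl
    h-mono : ∀ {q r} {μ μ′ : Presheaf A q} {ν ν′ : Presheaf A r} →
             (∀ {p} (x : ∣ A ∣₀ p) → app μ′ x refl ≤ app μ x refl) →
             (∀ {p} (x : ∣ A ∣₀ p) → app ν x refl ≤ app ν′ x refl) →
             h μ ν ≤ h μ′ ν′
    h-mono μ′≤μ ν≤ν′ = ⋀-mono λ { (_ , x) → ↙-mono (ν≤ν′ x) (μ′≤μ x) }

  IsColim : {A B : QCat Q} → QFunctor A B → ∀ {q} → Presheaf A q → ∣ B ∣₀ q → Set ℓ
  IsColim {B = B} F μ c =
    ∀ {r} (y : ∣ B ∣₀ r) → hom B c y ≈ app (graph F ⇙ μ) refl y

  IsLim : {A B : QCat Q} → QFunctor A B → ∀ {q} → Copresheaf A q → ∣ B ∣₀ q → Set ℓ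
  IsLim {B = B} F λ′ l =
    ∀ {r} (y : ∣ B ∣₀ r) → hom B y l ≈ app (λ′ ⇘ cograph F) y refl

  -- Completeness is by weighted colimits; the domain of F is any small Q-category.
  Complete : QCat Q → Set (suc ℓ)
  Complete B = (A : QCat Q) (F : QFunctor A B) → ∀ {q} (μ : Presheaf A q) →
               ∃[ c ] IsColim F μ c

  Dense : {A B : QCat Q} → QFunctor A B → Set ℓ
  Dense {A} {B} F = ∀ {q} (y : ∣ B ∣₀ q) →
    Σ (Presheaf A q) λ μ → ∃[ c ] (IsColim F μ c × QCat._≅_ B y c)

  Codense : {A B : QCat Q} → QFunctor A B → Set ℓ
  Codense {A} {B} F = ∀ {q} (y : ∣ B ∣₀ q) →
    Σ (Copresheaf A q) λ λ′ → ∃[ l ] (IsLim F λ′ l × QCat._≅_ B y l)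

  infix 10 _^* _₍*₎

  _^* : {A B : QCat Q} → A ⇸ B → ∀ {q} → Presheaf B q → Presheaf A q
  (φ ^*) ν = ν ⊙ φ

  _₍*₎ : {A B : QCat Q} → A ⇸ B → ∀ {q} → Presheaf A q → Presheaf B q
  (φ ₍*₎) μ = μ ⇙ φ

  K : {A B : QCat Q} → A ⇸ B → QCat Q
  K {B = B} φ = Subcategory (P B) λ ν → (φ ₍*₎) ((φ ^*) ν) ≋ ν

  -- In the presheaf u ↙ A(a,-) the meet runs over the single object of {|a|}, so
  -- its value at x is u ↙ A(a,x).
  Bar : QCat Q → QCat Q
  Bar A = Subcategory (P A) λ {q} μ →
    Σ Obj λ p → Σ (∣ A ∣₀ p) λ a → Σ (Arr p q) λ u →
      ∀ {r} (x : ∣ A ∣₀ r) → app μ x refl ≈ (u ↙ hom A a x)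

  -- A^▷
  eval▷ : (A : QCat Q) → A ⇸ Bar A
  eval▷ A = mk⇸
    (λ a (μ , _) → app μ a refl)
    (λ a _ _ → ↙-elim (⋀-lower _ (_ , a)))
    (λ a a′ (μ , _) → actʳ μ a a′ refl)

  infix 10 _▷
  _▷ : {A B : QCat Q} → A ⇸ B → B ⇸ Bar A
  _▷ {A} φ = eval▷ A ⇙ φ

{-# OPTIONS --safe #-}
module Submission where

-- Suppose first that X is Kφ itself.  Its objects are the closed presheaves,
-- those fixed by φ_* φ^*.  Put F₀ b = φ_* φ^* (B(-,b)) and G₀ μ = φ_* μ.  The
-- Yoneda lemma and closedness give Kφ(F₀ b, κ) = κ(b) (`F₀-hom`), so every
-- closed ν is the ν-weighted colimit of F₀, and Kφ(F₀ b, G₀ μ) = (φ_* μ)(b),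
-- which is φ^▷(b,μ).  For codensity write ν = φ_* η with η = φ^* ν; through the
-- adjunction φ^* ⊣ φ_*, ν is the limit of G₀ weighted by PA(η,-) as soon as
--   PA(ζ,η) = ⋀_{μ ∈ Bar A} PA(η,μ) ↘ PA(ζ,μ),
-- and for this the presheaves η(a) ↙ A(a,-) suffice, because they lie above η
-- and agree with η at a (`bar-codense`).  Density, codensity and the value
-- G^♮ ∘ F_♮ = X(F-,G-) are then carried along an isomorphism.
--
-- Conversely, given F and G, send x to the nerve X(F-,x).
--   * It is closed: if x is the limit of G weighted by λ, then X(F-,x) is
--     λ ↘ φ^▷ = φ_* (λ ↘ A^▷), and every presheaf in the image of φ_* is
--     closed (`nerve-fixed`).
--   * The nerve is fully faithful because F is dense (`nerve-full`).
--   * A closed ν is the nerve of c = colim_ν F (`nerve-colim`).  With η = φ^* ν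
--     and μ = η(a) ↙ A(a,-), one has η ⊑ μ, and since
--     X(c,Gμ) = PB(ν, φ_* μ) = PA(η,μ), this says c ⊑ Gμ.  Hence
--     X(Fb,c) ∘ φ(a,b) ≤ φ^▷(b,μ) ∘ φ(a,b) ≤ η(a) for every a, that is
--     X(Fb,c) ≤ (φ_* η)(b) = ν(b).
-- A fully faithful functor out of a separated category with a section on
-- objects is an isomorphism (`ff+surj⇒iso`).

open import Defs
open import Level using (Level)
open import Data.Product using (Σ; _×_; _,_; proj₁; proj₂)
open import Function.Bundles using (_⇔_; mk⇔)
open import Relation.Binary.Bundles using (Setoid)
open import Relation.Binary.PropositionalEquality using (_≡_; refl)

module _ {ℓ : Level} {Q : Quantaloid ℓ} where
  open Quantaloid Q
  open QCat using (Ob; ∣_∣₀; hom; hom-cong; hom-id; hom-comp)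
  open QFunctor
  open _⇸_

  -- Order and residuation

  ≤∘-unitˡ : ∀ {p q} {e : Arr q q} (u : Arr p q) → 1ₐ ≤ e → u ≤ (e ∘ u)
  ≤∘-unitˡ u 1≤e = ≤-trans (≤-reflexive (Eq.sym (∘-idˡ u))) (∘-monoˡ u 1≤e)

  ≤∘-unitʳ : ∀ {p q} {e : Arr p p} (u : Arr p q) → 1ₐ ≤ e → u ≤ (u ∘ e)
  ≤∘-unitʳ u 1≤e = ≤-trans (≤-reflexive (Eq.sym (∘-idʳ u))) (∘-monoʳ u 1≤e)

  module _ {A B C : QCat Q} where

    -- The universal properties of `⇙` and `⇘` at single objects.  The
    -- distributors are explicit because `app (ξ ⇙ φ) y z` unfolds to a meet from
    -- which they cannot be recovered.
    ⇙-intro : (ξ : A ⇸ C) (φ : A ⇸ B) → ∀ {q r} {y : ∣ B ∣₀ q} {z : ∣ C ∣₀ r} {u : Arr q r} →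
              (∀ {p} (x : ∣ A ∣₀ p) → (u ∘ app φ x y) ≤ app ξ x z) → u ≤ app (ξ ⇙ φ) y z
    ⇙-intro ξ φ u∘φ≤ξ = ⋀-greatest _ λ (_ , x) → ↙-intro (u∘φ≤ξ x)

    ⇙-elim : (ξ : A ⇸ C) (φ : A ⇸ B) → ∀ {q r} {y : ∣ B ∣₀ q} {z : ∣ C ∣₀ r} {u : Arr q r} →
             u ≤ app (ξ ⇙ φ) y z → ∀ {p} (x : ∣ A ∣₀ p) → (u ∘ app φ x y) ≤ app ξ x z
    ⇙-elim ξ φ u≤ x = ↙-elim (≤-trans u≤ (⋀-lower _ (_ , x)))

    ⇘-intro : (ψ : B ⇸ C) (ξ : A ⇸ C) → ∀ {p q} {x : ∣ A ∣₀ p} {y : ∣ B ∣₀ q} {u : Arr p q} →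
              (∀ {r} (z : ∣ C ∣₀ r) → (app ψ y z ∘ u) ≤ app ξ x z) → u ≤ app (ψ ⇘ ξ) x y
    ⇘-intro ψ ξ ψ∘u≤ξ = ⋀-greatest _ λ (_ , z) → ↘-intro (ψ∘u≤ξ z)

    ⇘-elim : (ψ : B ⇸ C) (ξ : A ⇸ C) → ∀ {p q} {x : ∣ A ∣₀ p} {y : ∣ B ∣₀ q} {u : Arr p q} →
             u ≤ app (ψ ⇘ ξ) x y → ∀ {r} (z : ∣ C ∣₀ r) → (app ψ y z ∘ u) ≤ app ξ x z
    ⇘-elim ψ ξ u≤ z = ↘-elim (≤-trans u≤ (⋀-lower _ (_ , z)))

  -- Functors and weighted (co)limits

  infixr 9 _∘F_
  _∘F_ : {A B C : QCat Q} → QFunctor B C → QFunctor A B → QFunctor A C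
  G ∘F F = record
    { map      = λ x → map G (map F x)
    ; map-cong = λ e → map-cong G (map-cong F e)
    ; map-hom  = λ x x′ → ≤-trans (map-hom F x x′) (map-hom G _ _)
    }

  module _ (A : QCat Q) where
    open QCat A using (_≈₀_; _⊑_)

    ≈⇒⊑ : ∀ {q} (x y : ∣ A ∣₀ q) → x ≈₀ y → x ⊑ y
    ≈⇒⊑ {q} x y x≈y =
      ≤-trans (hom-id A x) (≤-reflexive (hom-cong A (Setoid.refl (Ob A q)) x≈y))

    ⊑-trans : ∀ {q} (x y z : ∣ A ∣₀ q) → x ⊑ y → y ⊑ z → x ⊑ z
    ⊑-trans x y z x⊑y y⊑z =
      ≤-trans x⊑y (≤-trans (≤∘-unitˡ _ y⊑z) (hom-comp A x y z))

    ⊑-homˡ : ∀ {q r} (x y : ∣ A ∣₀ q) (z : ∣ A ∣₀ r) → x ⊑ y → hom A y z ≤ hom A x z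
    ⊑-homˡ x y z x⊑y = ≤-trans (≤∘-unitʳ _ x⊑y) (hom-comp A x y z)

    ⊑-homʳ : ∀ {q r} (x y : ∣ A ∣₀ q) (z : ∣ A ∣₀ r) → x ⊑ y → hom A z x ≤ hom A z y
    ⊑-homʳ x y z x⊑y = ≤-trans (≤∘-unitˡ _ x⊑y) (hom-comp A z x y)

  -- The unit of a weighted colimit: its universal property at the identity.
  colim-unit : {A B : QCat Q} (F : QFunctor A B) → ∀ {q} (μ : Presheaf A q) {c : ∣ B ∣₀ q} →
               IsColim F μ c →
               ∀ {p} (x : ∣ A ∣₀ p) → app μ x refl ≤ hom B (map F x) c
  colim-unit {B = B} F μ {c} colim x = ≤-trans
    (≤∘-unitˡ _ (hom-id B c))
    (⇙-elim (graph F) μ (≤-reflexive (colim c)) x)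

  lim-counit : {A B : QCat Q} (G : QFunctor A B) → ∀ {q} (λ′ : Copresheaf A q) {l : ∣ B ∣₀ q} →
               IsLim G λ′ l → ∀ {r} (y : ∣ B ∣₀ r) → ∀ {p} (x : ∣ A ∣₀ p) →
               (app λ′ refl x ∘ hom B y l) ≤ hom B y (map G x)
  lim-counit G λ′ lim y x = ⇘-elim λ′ (cograph G) (≤-reflexive (lim y)) x

  -- G^♮ ∘ F_♮ = X(F-,G-): the join over the objects of the common codomain is
  -- attained at F x.
  cograph⊙graph : {A B C : QCat Q} (F : QFunctor A B) (G : QFunctor C B) →
    ∀ {p q} (x : ∣ A ∣₀ p) (z : ∣ C ∣₀ q) →
    app (cograph G ⊙ graph F) x z ≈ hom B (map F x) (map G z)
  cograph⊙graph {B = B} F G x z = antisym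
    (⋁-least _ λ (_ , y) → hom-comp B (map F x) y (map G z))
    (≤-trans (≤∘-unitʳ _ (hom-id B (map F x))) (⋁-upper _ (_ , map F x)))

  -- Isomorphisms and transfer of density along them

  module _ {X Y : QCat Q} (I : Isomorphic X Y) where
    open Isomorphic I

    private
      symX : ∀ {q} {x y : ∣ X ∣₀ q} → QCat._≈₀_ X x y → QCat._≈₀_ X y x
      symX {q} = Setoid.sym (Ob X q)
      symY : ∀ {q} {x y : ∣ Y ∣₀ q} → QCat._≈₀_ Y x y → QCat._≈₀_ Y y x
      symY {q} = Setoid.sym (Ob Y q)

    from⊣to : ∀ {p q} (y : ∣ Y ∣₀ p) (x : ∣ X ∣₀ q) → hom X (map from y) x ≈ hom Y y (map to x)
    from⊣to y x = antisym
      (≤-trans (map-hom to _ _) (⊑-homˡ Y _ _ _ (≈⇒⊑ Y _ _ (symY (to-from y)))))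
      (≤-trans (map-hom from _ _) (⊑-homʳ X _ _ _ (≈⇒⊑ X _ _ (from-to x))))

    to⊣from : ∀ {p q} (x : ∣ X ∣₀ p) (y : ∣ Y ∣₀ q) → hom X x (map from y) ≈ hom Y (map to x) y
    to⊣from x y = antisym
      (≤-trans (map-hom to _ _) (⊑-homʳ Y _ _ _ (≈⇒⊑ Y _ _ (to-from y))))
      (≤-trans (map-hom from _ _) (⊑-homˡ X _ _ _ (≈⇒⊑ X _ _ (symX (from-to x)))))

    from-full : ∀ {p q} (y : ∣ Y ∣₀ p) (y′ : ∣ Y ∣₀ q) →
                hom X (map from y) (map from y′) ≈ hom Y y y′
    from-full y y′ = antisym
      (≤-trans (≤-reflexive (from⊣to y _)) (⊑-homʳ Y _ _ _ (≈⇒⊑ Y _ _ (to-from y′))))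
      (map-hom from y y′)

    -- The adjunctions from ⊣ to ⊣ from make `from` preserve weighted colimits
    -- and limits, so (co)density needs no change of weight.
    Dense-from : {B : QCat Q} (F : QFunctor B Y) → Dense F → Dense (from ∘F F)
    Dense-from F dense x with dense (map to x)
    ... | μ , c , colim , tx⊑c , c⊑tx =
      μ , map from c , colim′ ,
      ≤-trans tx⊑c (≤-reflexive (Eq.sym (to⊣from x c))) ,
      ≤-trans c⊑tx (≤-reflexive (Eq.sym (from⊣to c x)))
      where
      colim′ : IsColim (from ∘F F) μ (map from c)
      colim′ y = antisym
        (⇙-intro (graph (from ∘F F)) μ λ b → ≤-trans
          (⇙-elim (graph F) μ
            (≤-trans (≤-reflexive (from⊣to c y)) (≤-reflexive (colim (map to y)))) b)
          (≤-reflexive (Eq.sym (from⊣to (map F b) y))))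
        (≤-trans
          (⇙-intro (graph F) μ λ b → ≤-trans
            (⇙-elim (graph (from ∘F F)) μ ≤-refl b)
            (≤-reflexive (from⊣to (map F b) y)))
          (≤-reflexive (Eq.trans (Eq.sym (colim (map to y))) (Eq.sym (from⊣to c y)))))

    Codense-from : {C : QCat Q} (G : QFunctor C Y) → Codense G → Codense (from ∘F G)
    Codense-from G codense x with codense (map to x)
    ... | λ′ , l , lim , tx⊑l , l⊑tx =
      λ′ , map from l , lim′ ,
      ≤-trans tx⊑l (≤-reflexive (Eq.sym (to⊣from x l))) ,
      ≤-trans l⊑tx (≤-reflexive (Eq.sym (from⊣to l x)))
      where
      lim′ : IsLim (from ∘F G) λ′ (map from l)
      lim′ y = antisym
        (⇘-intro λ′ (cograph (from ∘F G)) λ c → ≤-trans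
          (⇘-elim λ′ (cograph G)
            (≤-trans (≤-reflexive (to⊣from y l)) (≤-reflexive (lim (map to y)))) c)
          (≤-reflexive (Eq.sym (to⊣from y (map G c)))))
        (≤-trans
          (⇘-intro λ′ (cograph G) λ c → ≤-trans
            (⇘-elim λ′ (cograph (from ∘F G)) ≤-refl c)
            (≤-reflexive (to⊣from y (map G c))))
          (≤-reflexive (Eq.trans (Eq.sym (lim (map to y))) (Eq.sym (to⊣from y l)))))

  -- The section s need only invert T on one side up to equality; separatedness
  -- of X makes it respect equality and invert T on the other side.
  ff+surj⇒iso : {X Y : QCat Q} → Separated X → (T : QFunctor X Y) →
    (∀ {p q} (x : ∣ X ∣₀ p) (x′ : ∣ X ∣₀ q) → hom Y (map T x) (map T x′) ≤ hom X x x′) →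
    (s : ∀ {q} → ∣ Y ∣₀ q → ∣ X ∣₀ q) →
    (∀ {q} (y : ∣ Y ∣₀ q) → QCat._≈₀_ Y (map T (s y)) y) →
    Isomorphic X Y
  ff+surj⇒iso {X} {Y} sep T full s Ts≈ = record
    { to      = T
    ; from    = record
      { map      = s
      ; map-cong = λ {_} {y} {y′} y≈y′ → sep _ _
          ( reflect (⊑-trans Y _ _ _ (Ts⊑ y) (⊑-trans Y _ _ _ (≈⇒⊑ Y _ _ y≈y′) (⊑Ts y′)))
          , reflect (⊑-trans Y _ _ _ (Ts⊑ y′) (⊑-trans Y _ _ _ (≈⇒⊑ Y _ _ (symY y≈y′)) (⊑Ts y))))
      ; map-hom  = λ y y′ → ≤-trans
          (≤-trans (⊑-homˡ Y _ _ y′ (Ts⊑ y)) (⊑-homʳ Y _ _ _ (⊑Ts y′))) (full (s y) (s y′))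
      }
    ; from-to = λ x → sep _ _ (reflect (Ts⊑ (map T x)) , reflect (⊑Ts (map T x)))
    ; to-from = Ts≈
    }
    where
    open QCat X using () renaming (_⊑_ to _⊑X_)
    open QCat Y using () renaming (_⊑_ to _⊑Y_)
    symY : ∀ {q} {x y : ∣ Y ∣₀ q} → QCat._≈₀_ Y x y → QCat._≈₀_ Y y x
    symY {q} = Setoid.sym (Ob Y q)
    Ts⊑ : ∀ {q} (y : ∣ Y ∣₀ q) → map T (s y) ⊑Y y
    Ts⊑ y = ≈⇒⊑ Y _ _ (Ts≈ y)
    ⊑Ts : ∀ {q} (y : ∣ Y ∣₀ q) → y ⊑Y map T (s y)
    ⊑Ts y = ≈⇒⊑ Y _ _ (symY (Ts≈ y))
    reflect : ∀ {q} {x x′ : ∣ X ∣₀ q} → map T x ⊑Y map T x′ → x ⊑X x′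
    reflect Tx⊑Tx′ = ≤-trans Tx⊑Tx′ (full _ _)

  -- Presheaves

  -- A presheaf is determined by its values at the only object `refl` of {q};
  -- likewise for copresheaves.
  mkPresheaf : {A : QCat Q} → ∀ {q} (f : ∀ {p} → ∣ A ∣₀ p → Arr p q) →
               (∀ {p p′} (x : ∣ A ∣₀ p) (x′ : ∣ A ∣₀ p′) → (f x ∘ hom A x′ x) ≤ f x′) →
               Presheaf A q
  mkPresheaf {A} {q} f f-act = mk⇸ g
    (λ { x refl refl → ≤-reflexive (∘-idˡ _) })
    (λ { x x′ refl → f-act x x′ })
    where
    g : ∀ {p r} → ∣ A ∣₀ p → r ≡ q → Arr p r
    g x refl = f x

  mkCopresheaf : {A : QCat Q} → ∀ {q} (f : ∀ {p} → ∣ A ∣₀ p → Arr q p) →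
                 (∀ {p p′} (x : ∣ A ∣₀ p) (x′ : ∣ A ∣₀ p′) → (hom A x x′ ∘ f x) ≤ f x′) →
                 Copresheaf A q
  mkCopresheaf {A} {q} f f-act = mk⇸ g
    (λ { refl x x′ → f-act x x′ })
    (λ { refl refl x → ≤-reflexive (∘-idʳ _) })
    where
    g : ∀ {p r} → r ≡ q → ∣ A ∣₀ p → Arr r p
    g refl x = f x

  module _ (A : QCat Q) where
    private module PA = QCat (P A)

    P-hom-elim : ∀ {q r} (μ : Presheaf A q) (μ′ : Presheaf A r) →
                 ∀ {p} (x : ∣ A ∣₀ p) → (PA.hom μ μ′ ∘ app μ x refl) ≤ app μ′ x refl
    P-hom-elim μ μ′ x = ⇙-elim μ′ μ ≤-refl x

    P-⊑-intro : ∀ {q} (μ μ′ : Presheaf A q) →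
                (∀ {p} (x : ∣ A ∣₀ p) → app μ x refl ≤ app μ′ x refl) → μ PA.⊑ μ′
    P-⊑-intro μ μ′ μ≤μ′ = ⇙-intro μ′ μ λ x → ≤-trans (≤-reflexive (∘-idˡ _)) (μ≤μ′ x)

    P-⊑-elim : ∀ {q} (μ μ′ : Presheaf A q) → μ PA.⊑ μ′ →
               ∀ {p} (x : ∣ A ∣₀ p) → app μ x refl ≤ app μ′ x refl
    P-⊑-elim μ μ′ μ⊑μ′ x = ≤-trans (≤∘-unitˡ _ μ⊑μ′) (P-hom-elim μ μ′ x)

    P-separated : Separated (P A)
    P-separated μ μ′ (μ⊑μ′ , μ′⊑μ) x refl =
      antisym (P-⊑-elim μ μ′ μ⊑μ′ x) (P-⊑-elim μ′ μ μ′⊑μ x)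

    -- The representable presheaf A(-,b).
    yoneda : ∀ {q} → ∣ A ∣₀ q → Presheaf A q
    yoneda b = mkPresheaf (λ x → hom A x b) (λ x x′ → hom-comp A x′ x b)

    yonedaF : QFunctor A (P A)
    yonedaF = record
      { map      = yoneda
      ; map-cong = λ { b≈b′ x refl → hom-cong A (Setoid.refl (Ob A _)) b≈b′ }
      ; map-hom  = λ b b′ → ⇙-intro (yoneda b′) (yoneda b) λ x → hom-comp A x b b′
      }

    -- The converse inequality is `P-hom-elim` at b, composed with 1 ≤ A(b,b).
    yoneda-lemma : ∀ {q r} (b : ∣ A ∣₀ q) (μ : Presheaf A r) →
                   app μ b refl ≤ PA.hom (yoneda b) μ
    yoneda-lemma b μ = ⇙-intro μ (yoneda b) λ x → actʳ μ b x refl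

    -- The object u ↙ A(a,-) of Bar A, with a and u as its witnesses.
    bar : ∀ {p r} → ∣ A ∣₀ p → Arr p r → ∣ Bar A ∣₀ r
    bar {p} a u =
      mkPresheaf (λ x → u ↙ hom A a x)
        (λ x x′ → ↙-intro (≤-trans ∘-assoc-≤
          (≤-trans (∘-monoʳ _ (hom-comp A a x′ x)) (↙-elim ≤-refl)))) ,
      p , a , u , λ _ → Eq.refl

    -- Equality holds when u is a value η(a) of a presheaf, the case used below.
    bar-at : ∀ {p r} (a : ∣ A ∣₀ p) (u : Arr p r) → app (proj₁ (bar a u)) a refl ≤ u
    bar-at a u = ≤-trans (≤∘-unitʳ _ (hom-id A a)) (↙-elim ≤-refl)

    -- Every η lies below η(a) ↙ A(a,-): this is the action of A on η.
    ⊑-bar : ∀ {p q} (η : Presheaf A q) (a : ∣ A ∣₀ p) → η PA.⊑ proj₁ (bar a (app η a refl))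
    ⊑-bar η a = P-⊑-intro η (proj₁ (bar a (app η a refl))) λ x → ↙-intro (actʳ η x a refl)

    -- The inclusion of Bar A in PA is codense, with η the limit weighted by
    -- PA(η,-).
    bar-codense : ∀ {q r} (ζ : Presheaf A q) (η : Presheaf A r) {v : Arr q r} →
      (∀ {s} (μ : ∣ Bar A ∣₀ s) → (PA.hom η (proj₁ μ) ∘ v) ≤ PA.hom ζ (proj₁ μ)) →
      v ≤ PA.hom ζ η
    bar-codense ζ η h = ⇙-intro η ζ λ a →
      -- Only the presheaf η(a) ↙ A(a,-) is tested to bound v ∘ ζ(a) by η(a).
      let μ = bar a (app η a refl) in
      ≤-trans
        (⇙-elim (proj₁ μ) ζ (≤-trans (≤∘-unitˡ _ (⊑-bar η a)) (h μ)) a)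
        (bar-at a (app η a refl))

  -- The Kan adjunction and its fixed points

  module Kan {A B : QCat Q} (φ : A ⇸ B) where
    private
      module PA = QCat (P A)
      module PB = QCat (P B)

    -- Together with `coadjunct`: PA(φ^* ν, μ) = PB(ν, φ_* μ).
    adjunct : ∀ {q r} (ν : Presheaf B q) (μ : Presheaf A r) →
              PA.hom ((φ ^*) ν) μ ≤ PB.hom ν ((φ ₍*₎) μ)
    adjunct ν μ = ⇙-intro ((φ ₍*₎) μ) ν λ b → ⇙-intro μ φ λ a → ≤-trans ∘-assoc-≤
      (≤-trans (∘-monoʳ _ (⋁-upper _ (_ , b))) (P-hom-elim A ((φ ^*) ν) μ a))

    coadjunct : ∀ {q r} (ν : Presheaf B q) (μ : Presheaf A r) →
                PB.hom ν ((φ ₍*₎) μ) ≤ PA.hom ((φ ^*) ν) μ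
    coadjunct ν μ = ⇙-intro μ ((φ ^*) ν) λ a → ≤-trans (≤-reflexive (∘-⋁ʳ _ _))
      (⋁-least _ λ (_ , b) → ≤-trans ∘-assoc-≥
        (⇙-elim μ φ (P-hom-elim B ν ((φ ₍*₎) μ) b) a))

    unit : ∀ {q} (ν : Presheaf B q) → ν PB.⊑ (φ ₍*₎) ((φ ^*) ν)
    unit ν = ≤-trans (PA.hom-id ((φ ^*) ν)) (adjunct ν ((φ ^*) ν))

    lower-hom : ∀ {q r} (μ : Presheaf A q) (μ′ : Presheaf A r) →
                PA.hom μ μ′ ≤ PB.hom ((φ ₍*₎) μ) ((φ ₍*₎) μ′)
    lower-hom μ μ′ = ⇙-intro ((φ ₍*₎) μ′) ((φ ₍*₎) μ) λ b → ⇙-intro μ′ φ λ a → ≤-trans ∘-assoc-≤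
      (≤-trans (∘-monoʳ _ (⇙-elim μ φ ≤-refl a)) (P-hom-elim A μ μ′ a))

    upper-hom : ∀ {q r} (ν : Presheaf B q) (ν′ : Presheaf B r) →
                PB.hom ν ν′ ≤ PA.hom ((φ ^*) ν) ((φ ^*) ν′)
    upper-hom ν ν′ = ≤-trans
      (⊑-homʳ (P B) ν′ ((φ ₍*₎) ((φ ^*) ν′)) ν (unit ν′)) (coadjunct ν ((φ ^*) ν′))

    -- Presheaves in the image of φ_* are closed, since φ_* φ^* φ_* = φ_*.
    fixed : ∀ {q} (ν : Presheaf B q) (η : Presheaf A q) → ν ≋ (φ ₍*₎) η →
            (φ ₍*₎) ((φ ^*) ν) ≋ ν
    fixed ν η ν≋ = P-separated B ((φ ₍*₎) ((φ ^*) ν)) ν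
      ( ⊑-trans (P B) ((φ ₍*₎) ((φ ^*) ν)) ((φ ₍*₎) η) ν
          (≤-trans (≤-trans (≈⇒⊑ (P B) ν ((φ ₍*₎) η) ν≋) (coadjunct ν η))
            (lower-hom ((φ ^*) ν) η))
          (≈⇒⊑ (P B) ((φ ₍*₎) η) ν λ x y → Eq.sym (ν≋ x y))
      , unit ν)

    -- φ_* as a functor PA → Kφ.
    lower : QFunctor (P A) (K φ)
    lower = record
      { map      = λ μ → (φ ₍*₎) μ , fixed ((φ ₍*₎) μ) μ (λ _ _ → Eq.refl)
      ; map-cong = λ {_} {μ} {μ′} μ≋μ′ → P-separated B ((φ ₍*₎) μ) ((φ ₍*₎) μ′)
          ( ≤-trans (≈⇒⊑ (P A) μ μ′ μ≋μ′) (lower-hom μ μ′)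
          , ≤-trans (≈⇒⊑ (P A) μ′ μ (λ x y → Eq.sym (μ≋μ′ x y))) (lower-hom μ′ μ))
      ; map-hom  = lower-hom
      }

    -- φ^* as a functor PB → PA.
    upper : QFunctor (P B) (P A)
    upper = record
      { map      = φ ^*
      ; map-cong = λ {_} {ν} {ν′} ν≋ν′ → P-separated A ((φ ^*) ν) ((φ ^*) ν′)
          ( ≤-trans (≈⇒⊑ (P B) ν ν′ ν≋ν′) (upper-hom ν ν′)
          , ≤-trans (≈⇒⊑ (P B) ν′ ν (λ x y → Eq.sym (ν≋ν′ x y))) (upper-hom ν′ ν))
      ; map-hom  = upper-hom
      }

    inclusion : QFunctor (Bar A) (P A)
    inclusion = record { map = proj₁ ; map-cong = λ e → e ; map-hom = λ _ _ → ≤-refl }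

    -- F₀ sends b to the closure of B(-,b); G₀ is φ_* restricted to Bar A.
    F₀ : QFunctor B (K φ)
    F₀ = lower ∘F upper ∘F yonedaF B

    G₀ : QFunctor (Bar A) (K φ)
    G₀ = lower ∘F inclusion

    -- The Yoneda lemma for Kφ; closedness of κ is what lets B(-,b) be replaced by
    -- its closure.
    F₀-hom : ∀ {q r} (b : ∣ B ∣₀ q) (κ : ∣ K φ ∣₀ r) →
             hom (K φ) (map F₀ b) κ ≈ app (proj₁ κ) b refl
    F₀-hom b (κ , fix) = antisym
      (≤-trans
        (≤∘-unitʳ _ (≤-trans (hom-id B b)
          (P-⊑-elim B (yoneda B b) (proj₁ (map F₀ b)) (unit (yoneda B b)) b)))
        (P-hom-elim B (proj₁ (map F₀ b)) κ b))
      (≤-trans (yoneda-lemma B b κ)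
        (≤-trans (upper-hom (yoneda B b) κ)
          (≤-trans (lower-hom ((φ ^*) (yoneda B b)) ((φ ^*) κ))
            (⊑-homʳ (P B) ((φ ₍*₎) ((φ ^*) κ)) κ (proj₁ (map F₀ b))
              (≈⇒⊑ (P B) ((φ ₍*₎) ((φ ^*) κ)) κ fix)))))

    F₀-dense : Dense F₀
    F₀-dense κ = proj₁ κ , κ , colim , hom-id (K φ) κ , hom-id (K φ) κ
      where
      colim : IsColim F₀ (proj₁ κ) κ
      colim κ′ = antisym
        (⇙-intro (graph F₀) (proj₁ κ) {z = κ′} λ b → ≤-trans (P-hom-elim B (proj₁ κ) (proj₁ κ′) b)
          (≤-reflexive (Eq.sym (F₀-hom b κ′))))
        (⇙-intro (proj₁ κ′) (proj₁ κ) λ b → ≤-trans (⇙-elim (graph F₀) (proj₁ κ) {z = κ′} ≤-refl b)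
          (≤-reflexive (F₀-hom b κ′)))

    G₀-codense : Codense G₀
    G₀-codense (ν , fix) = λ′ , map lower η , lim ,
        ≈⇒⊑ (P B) ν ((φ ₍*₎) η) (λ x y → Eq.sym (fix x y)) , ≈⇒⊑ (P B) ((φ ₍*₎) η) ν fix
      where
      η : Presheaf A _
      η = (φ ^*) ν
      -- The weight PA(η,-).
      λ′ : Copresheaf (Bar A) _
      λ′ = mkCopresheaf (λ μ → PA.hom η (proj₁ μ))
             (λ μ μ′ → PA.hom-comp η (proj₁ μ) (proj₁ μ′))
      lim : IsLim G₀ λ′ (map lower η)
      lim κ₀@(κ , _) = antisym
        (⇘-intro λ′ (cograph G₀) {x = κ₀} λ (μ , _) → ≤-trans
          (∘-monoˡ _ (lower-hom η μ)) (PB.hom-comp κ ((φ ₍*₎) η) ((φ ₍*₎) μ)))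
        (≤-trans
          (bar-codense A ((φ ^*) κ) η λ μ → ≤-trans
            (⇘-elim λ′ (cograph G₀) {x = κ₀} ≤-refl μ) (coadjunct κ (proj₁ μ)))
          (adjunct κ η))

  -- Nerves along the dense functor

  -- The hypothesis on G^♮ ∘ F_♮ is taken in the form φ^▷ = X(F-,G-).
  module Represent {A B : QCat Q} (φ : A ⇸ B) {X : QCat Q}
    (F : QFunctor B X) (G : QFunctor (Bar A) X) (denseF : Dense F) (codenseG : Codense G)
    (φ▷≈ : ∀ {p q} (b : ∣ B ∣₀ p) (μ : ∣ Bar A ∣₀ q) →
           app (φ ▷) b μ ≈ hom X (map F b) (map G μ))
    where

    -- The presheaf X(F-,x).
    nerve : ∀ {q} → ∣ X ∣₀ q → Presheaf B q
    nerve x = mkPresheaf (λ b → hom X (map F b) x) (λ b b′ → actʳ (graph F) b b′ x)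

    -- If x is the limit of G weighted by λ, the nerve of x is φ_* (λ ↘ A^▷).
    nerve-fixed : ∀ {q} (x : ∣ X ∣₀ q) → (φ ₍*₎) ((φ ^*) (nerve x)) ≋ nerve x
    nerve-fixed x with codenseG x
    ... | λ′ , l , lim , x⊑l , l⊑x = Kan.fixed φ (nerve x) η eq
      where
      η : Presheaf A _
      η = λ′ ⇘ eval▷ A
      eq : nerve x ≋ (φ ₍*₎) η
      eq b refl = antisym
        (⇙-intro η φ λ a → ⇘-intro λ′ (eval▷ A) λ μ → ≤-trans ∘-assoc-≥
          (⇙-elim (eval▷ A) φ {z = μ} (≤-trans (∘-monoʳ _ (⊑-homʳ X _ _ (map F b) x⊑l))
            (≤-trans (lim-counit G λ′ lim (map F b) μ) (≤-reflexive (Eq.sym (φ▷≈ b μ))))) a))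
        (≤-trans
          (⇘-intro λ′ (cograph G) λ μ → ≤-trans
            (⇙-intro (eval▷ A) φ {z = μ} λ a → ≤-trans ∘-assoc-≤
              (≤-trans (∘-monoʳ _ (⇙-elim η φ ≤-refl a)) (⇘-elim λ′ (eval▷ A) ≤-refl μ)))
            (≤-reflexive (φ▷≈ b μ)))
          (≤-trans (≤-reflexive (Eq.sym (lim (map F b)))) (⊑-homʳ X _ _ (map F b) l⊑x)))

    nerveF : QFunctor X (K φ)
    nerveF = record
      { map      = λ x → nerve x , nerve-fixed x
      ; map-cong = λ { x≈y b refl → hom-cong X (Setoid.refl (Ob X _)) x≈y }
      ; map-hom  = λ x y → ⇙-intro (nerve y) (nerve x) λ b → hom-comp X (map F b) x y
      }

    nerve-full : ∀ {p q} (x : ∣ X ∣₀ p) (y : ∣ X ∣₀ q) →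
                 hom (P B) (nerve x) (nerve y) ≤ hom X x y
    nerve-full x y with denseF x
    ... | μ , c , colim , x⊑c , c⊑x = ≤-trans
      (⇙-intro (graph F) μ λ b → ≤-trans
        (∘-monoʳ _ (≤-trans (colim-unit F μ colim b) (⊑-homʳ X _ _ (map F b) c⊑x)))
        (P-hom-elim B (nerve x) (nerve y) b))
      (≤-trans (≤-reflexive (Eq.sym (colim y))) (⊑-homˡ X _ _ y x⊑c))

    -- A closed presheaf ν is the nerve of the ν-weighted colimit of F.
    nerve-colim : ∀ {q} (ν : Presheaf B q) → (φ ₍*₎) ((φ ^*) ν) ≋ ν →
                  ∀ {c} → IsColim F ν c → nerve c ≋ ν
    nerve-colim ν fix {c} colim b refl = antisym
      (≤-trans (⇙-intro η φ λ a → bound a) (≤-reflexive (fix b refl)))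
      (colim-unit F ν colim b)
      where
      η : Presheaf A _
      η = (φ ^*) ν
      bound : ∀ {p} (a : ∣ A ∣₀ p) → (hom X (map F b) c ∘ app φ a b) ≤ app η a refl
      bound a = ≤-trans
        (⇙-elim (eval▷ A) φ {z = μ}
          (≤-trans (⊑-homʳ X _ _ (map F b) c⊑Gμ) (≤-reflexive (Eq.sym (φ▷≈ b μ)))) a)
        (bar-at A a (app η a refl))
        where
        μ : ∣ Bar A ∣₀ _
        μ = bar A a (app η a refl)
        -- X(c,Gμ) = PB(ν, φ_* μ) = PA(η,μ), and η ⊑ μ.
        c⊑Gμ : 1ₐ ≤ hom X c (map G μ)
        c⊑Gμ = ≤-trans
          (⇙-intro (graph F) ν λ b′ → ≤-trans
            (⇙-elim ((φ ₍*₎) (proj₁ μ)) ν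
              (≤-trans (⊑-bar A η a) (Kan.adjunct φ ν (proj₁ μ))) b′)
            (≤-reflexive (φ▷≈ b′ μ)))
          (≤-reflexive (Eq.sym (colim (map G μ))))

-- The data and conditions on the right-hand side of the equivalence.
Factorisation : {ℓ : Level} {Q : Quantaloid ℓ} {A B : QCat Q} (φ : A ⇸ B) (X : QCat Q) → Set ℓ
Factorisation {A = A} {B} φ X =
  Σ (QFunctor B X) λ F → Σ (QFunctor (Bar A) X) λ G →
    Dense F × Codense G × (φ ▷ ≋ cograph G ⊙ graph F)

theorem6p14 : {ℓ : Level} (Q : Quantaloid ℓ) (A B : QCat Q) (φ : A ⇸ B)
    (X : QCat Q) → Separated X → Complete X →
    Isomorphic X (K φ) ⇔
    (Σ (QFunctor B X) λ F → Σ (QFunctor (Bar A) X) λ G →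
    Dense F × Codense G × (φ ▷ ≋ cograph G ⊙ graph F))
theorem6p14 Q A B φ X separated complete = mk⇔ necessity sufficiency
  where
  open Quantaloid Q using (module Eq)
  open Kan φ

  necessity : Isomorphic X (K φ) → Factorisation φ X
  necessity I = from ∘F F₀ , from ∘F G₀ , Dense-from I F₀ F₀-dense , Codense-from I G₀ G₀-codense ,
    λ b μ → Eq.sym (Eq.trans (cograph⊙graph (from ∘F F₀) (from ∘F G₀) b μ)
      (Eq.trans (from-full I _ _) (F₀-hom b (QFunctor.map G₀ μ))))
    where open Isomorphic I

  sufficiency : Factorisation φ X → Isomorphic X (K φ)
  sufficiency (F , G , denseF , codenseG , φ▷≋) =
    ff+surj⇒iso separated nerveF nerve-full
      (λ (ν , _) → proj₁ (complete B F ν))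
      (λ (ν , fix) → nerve-colim ν fix (proj₂ (complete B F ν)))
    where open Represent φ F G denseF codenseG
            (λ b μ → Eq.trans (φ▷≋ b μ) (cograph⊙graph F G b μ))
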